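{- Let $n \geq t \geq 1$ be integers and let $\mathcal{F} = 2^{[n]}$. Then \[\beta(\mathcal{F},t) = \frac{l(\mathcal{F},t)}{|\mathcal{F}|} = \frac{|\mathcal{K}_{n,t}|}{2^n},\] where $\mathcal{K}_{n,t} = \{A \subseteq [n] : |A| \geq (n+t)/2\}$ if $n+t$ is even, and $\mathcal{K}_{n,t} = \{A \subseteq [n] : |A \cap [n-1]| \geq (n+t-1)/2\}$ if $n+t$ is odd.
   Context: $[n] = \{1,\dots,n\}$ and $2^{[n]}$ is the family of all subsets of $[n]$. A family $\mathcal{A}$ is $t$-intersecting if $|A \cap B| \geq t$ for all $A, B \in \mathcal{A}$ with $A \neq B$; $l(\mathcal{F},t)$ is the size of a largest $t$-intersecting sub-family of $\mathcal{F}$. For a family $\mathcal{A}$, $\mathcal{A}^{t,+} = \{A \in \mathcal{A} : |A \cap B| \geq t \text{ for all } B \in \mathcal{A}\setminus\{A\}\}$ and $\mathcal{A}^{t,- } = \mathcal{A} \setminus \mathcal{A}^{t,+}$. For $\mathcal{A} \subseteq \mathcal{F}$, $\beta(\mathcal{F},t,\mathcal{A}) = \frac{l(\mathcal{F},t) - |\mathcal{A}^{t,+}|}{|\mathcal{A}^{t,- }|}$ if $\mathcal{A}^{t,- } \neq \emptyset$, and $\frac{l(\mathcal{F},t)}{|\mathcal{F}|}$ otherwise; $\beta(\mathcal{F},t) = \min_{\mathcal{A} \subseteq \mathcal{F}} \beta(\mathcal{F},t,\mathcal{A})$. -}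

module Defs where

open import Data.Bool.Properties using () renaming (_≟_ to _≟ᵇ_)
open import Data.Fin using (toℕ)
open import Data.Fin.Subset using (Subset; inside; outside; _∩_; ∣_∣)
open import Data.Integer as ℤ using (+_)
open import Data.List using (List; []; _∷_; _++_; map; filter; length)
open import Data.List.Extrema.Nat using (max)
import Data.List.Extrema
open import Data.List.Relation.Unary.All using (All; all?)
open import Data.Nat using (ℕ; zero; suc; _+_; _∸_; _≤_; _≤?_; _<?_; NonZero)
open import Data.Nat.Divisibility using (_∣?_)
open import Data.Nat.DivMod as ℕ using ()
open import Data.Rational using (ℚ; _/_)
open import Data.Rational.Properties using (≤-decTotalOrder)
open import Data.Vec using ([]; _∷_; tabulate)
open import Data.Vec.Properties using (≡-dec)
open import Relation.Binary using (DecTotalOrder)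
open import Relation.Binary.PropositionalEquality using (_≢_)
open import Relation.Nullary using (Dec; yes; no; does; ¬?)
open import Relation.Nullary.Decidable using (_→-dec_)

open Data.List.Extrema (DecTotalOrder.totalOrder ≤-decTotalOrder) using () renaming (min to minℚ)

-- A family of subsets of [n] is a list without repetitions (as `powerset` is, and
-- as `subfamilies` and `filter` preserve), so `length` is its
-- cardinality. The index i : Fin n stands for the element toℕ i + 1 of [n].
Family : ℕ → Set
Family n = List (Subset n)

powerset : ∀ n → Family n
powerset zero    = [] ∷ []
powerset (suc n) = map (outside ∷_) (powerset n) ++ map (inside ∷_) (powerset n)

powerset-nonZero : ∀ n → NonZero (length (powerset n))
powerset-nonZero zero    = _
powerset-nonZero (suc n)
  with powerset n | powerset-nonZero n
... | _ ∷ _ | _ = _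

-- If ℱ has no repetitions, `subfamilies ℱ` lists every 𝒜 ⊆ ℱ exactly once,
-- again without repetitions.
subfamilies : ∀ {n} → Family n → List (Family n)
subfamilies []      = [] ∷ []
subfamilies (A ∷ ℱ) = subfamilies ℱ ++ map (A ∷_) (subfamilies ℱ)

MeetsOthers : ∀ {n} → ℕ → Family n → Subset n → Set
MeetsOthers t 𝒜 A = All (λ B → A ≢ B → t ≤ ∣ A ∩ B ∣) 𝒜

meetsOthers? : ∀ {n} t (𝒜 : Family n) A → Dec (MeetsOthers t 𝒜 A)
meetsOthers? t 𝒜 A =
  all? (λ B → ¬? (≡-dec _≟ᵇ_ A B) →-dec (t ≤? ∣ A ∩ B ∣)) 𝒜

Intersecting : ∀ {n} → ℕ → Family n → Set
Intersecting t 𝒜 = All (MeetsOthers t 𝒜) 𝒜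

intersecting? : ∀ {n} t (𝒜 : Family n) → Dec (Intersecting t 𝒜)
intersecting? t 𝒜 = all? (meetsOthers? t 𝒜) 𝒜

-- The default 0 of `max` is attained by the empty subfamily.
l : ∀ {n} → Family n → ℕ → ℕ
l ℱ t = max 0 (map length (filter (intersecting? t) (subfamilies ℱ)))

infix 8 _⟨_,+⟩ _⟨_,-⟩

_⟨_,+⟩ : ∀ {n} → Family n → ℕ → Family n
𝒜 ⟨ t ,+⟩ = filter (meetsOthers? t 𝒜) 𝒜

_⟨_,-⟩ : ∀ {n} → Family n → ℕ → Family n
𝒜 ⟨ t ,-⟩ = filter (λ A → ¬? (meetsOthers? t 𝒜 A)) 𝒜

βAt : ∀ {n} (ℱ : Family n) .{{_ : NonZero (length ℱ)}} → ℕ → Family n → ℚ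
βAt ℱ t 𝒜 with 𝒜 ⟨ t ,-⟩
... | []         = + l ℱ t / length ℱ
... | 𝒞@(_ ∷ _) = (+ l ℱ t ℤ.- + length (𝒜 ⟨ t ,+⟩)) / length 𝒞

-- The default value of `minℚ` is the value at 𝒜 = ℱ, itself a subfamily of ℱ.
β : ∀ {n} (ℱ : Family n) .{{_ : NonZero (length ℱ)}} → ℕ → ℚ
β ℱ t = minℚ (βAt ℱ t ℱ) (map (βAt ℱ t) (subfamilies ℱ))

-- The set [m] ∩ [n], as a subset of [n].
initial : ∀ {n} → ℕ → Subset n
initial m = tabulate (λ i → does (toℕ i <? m))

-- In each case the number being halved is even, so the natural number division
-- is exact; so is n + t ∸ 1, since an odd n + t is positive. For n ≥ 1,
-- `initial (n ∸ 1)` is [n-1].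
𝒦 : ∀ n → ℕ → Family n
𝒦 n t with 2 ∣? (n + t)
... | yes _ = filter (λ A → ((n + t) ℕ./ 2) ≤? ∣ A ∣) (powerset n)
... | no  _ = filter (λ A → ((n + t ∸ 1) ℕ./ 2) ≤? ∣ A ∩ initial (n ∸ 1) ∣) (powerset n)

{-# OPTIONS --safe #-}

-- Call A and B compatible when they agree on at least t points, i.e. their
-- Hamming distance is at most n ∸ t; a t-intersecting family is pairwise
-- compatible. By Kleitman’s diameter theorem a pairwise compatible family has at
-- most |𝒦| members. Compatibility is invariant under the translations
-- A ↦ A ⊙ X, so for 𝒜 with parts 𝒮 = 𝒜⁺ and 𝒱 = 𝒜⁻ and any X the family
-- 𝒮 ∪ (𝒱 ∩ (𝒦 ⊙ X)) is pairwise compatible; averaging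
-- |𝒮| + |𝒱 ∩ (𝒦 ⊙ X)| ≤ |𝒦| over all X gives |𝒮| + |𝒱| |𝒦| / 2 ^ n ≤ |𝒦|, which
-- is β(ℱ, t, 𝒜) ≥ |𝒦| / 2 ^ n.
--
-- For Kleitman’s theorem, up-compression turns pairwise compatible families into
-- t-intersecting ones. These are bounded by induction on n, t = 1 being the
-- pairing of complementary sets. For t ≥ 2, replace other elements by the first
-- one as long as possible: the members omitting the first element then form a
-- (t + 1)-intersecting family and those containing it a (t ∸ 1)-intersecting
-- family on the other n ∸ 1 points, and |𝒦| satisfies the same recursion.
module Submission where

open import Defs
open import Data.Bool using (Bool; true; false; _∧_; _∨_; not; T)
open import Data.Bool.Properties using (T-∧; T-∨) renaming (_≟_ to _≟ᵇ_)
open import Data.Fin.Subset using (Subset; inside; outside; _∩_; ∣_∣; ⊤)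
open import Data.Fin.Subset.Properties using (∩-identityʳ; ∣⊤∣≡n; ∣p∣≤n)
open import Data.Integer as ℤ using (+_)
import Data.Integer.Properties as ℤ
open import Data.List using (List; []; _∷_; _++_; map; filter; length)
open import Data.List.Extrema.Nat using (max≤v⁺; v≤max⁺)
import Data.List.Extrema
import Data.List.Membership.DecPropositional as DecMembership
open import Data.List.Membership.Propositional using (_∈_; lose)
open import Data.List.Membership.Propositional.Properties
  using (∈-++⁻; ∈-++⁺ˡ; ∈-++⁺ʳ; ∈-map⁻; ∈-map⁺; ∈-filter⁻; ∈-filter⁺)
open import Data.List.Properties using (length-++; length-map; filter-++)
open import Data.List.Relation.Binary.Sublist.Propositional using (_⊆_; []; _∷ʳ_; _∷_)
open import Data.List.Relation.Binary.Sublist.Propositional.Properties using (All-resp-⊆)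
open import Data.List.Relation.Unary.All as All using ([]; _∷_)
open import Data.List.Relation.Unary.All.Properties using (map⁺)
open import Data.List.Relation.Unary.AllPairs using ([]; _∷_)
open import Data.List.Relation.Unary.Any using (here)
open import Data.List.Relation.Unary.Unique.Propositional using (Unique)
import Data.List.Relation.Unary.Unique.Propositional.Properties as Unique
open import Data.Nat as ℕ hiding (_/_; _≟_)
open import Data.Nat.Divisibility using (_∣?_; divides)
open import Data.Nat.DivMod using (m*n/n≡m)
open import Data.Nat.Properties
open import Data.Nat.Tactic.RingSolver using (solve-∀)
open import Data.Product using (_×_; _,_; proj₁; proj₂; ∃-syntax)
open import Data.Rational as ℚ using (ℚ; _/_)
import Data.Rational.Properties as ℚ
open import Data.Rational.Unnormalised using (mkℚᵘ; *≤*)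
import Data.Rational.Unnormalised.Properties as ℚᵘ
open import Data.Sum using (_⊎_; inj₁; inj₂; [_,_]′)
open import Data.Vec using ([]; _∷_; zipWith)
open import Data.Vec.Properties using (≡-dec; zipWith-comm; ∷-injectiveʳ)
open import Function using (_∘_; Equivalence)
open import Level using (0ℓ)
open import Relation.Binary using (DecTotalOrder)
open import Relation.Binary.PropositionalEquality
open import Relation.Nullary using (¬_; Dec; yes; no; does; ¬?; contradiction)
open import Relation.Unary using (Pred; Decidable)

open Data.List.Extrema (DecTotalOrder.totalOrder ℚ.≤-decTotalOrder)
  using () renaming (min≤v⁺ to minℚ≤v⁺; v≤min⁺ to v≤minℚ⁺)

private variable
  n : ℕ

-- Sums over all subsets and sizes of families

-- Within the proof a family is a Boolean function on subsets, and sums recurse on the coordinates,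
-- so that splitting a family into its two sections at the first coordinate is a mere computation.
∑ : (Subset n → ℕ) → ℕ
∑ {zero}  f = f []
∑ {suc n} f = ∑ (f ∘ (outside ∷_)) + ∑ (f ∘ (inside ∷_))

𝟙 : Bool → ℕ
𝟙 true  = 1
𝟙 false = 0

size : (Subset n → Bool) → ℕ
size F = ∑ (𝟙 ∘ F)

infixr 7 _∩ᶠ_
infixr 6 _∪ᶠ_

_∩ᶠ_ _∪ᶠ_ : (F G : Subset n → Bool) → Subset n → Bool
(F ∩ᶠ G) A = F A ∧ G A
(F ∪ᶠ G) A = F A ∨ G A

_₀ _₁ : (Subset (suc n) → Bool) → Subset n → Bool
(F ₀) A = F (outside ∷ A)
(F ₁) A = F (inside ∷ A)

∑-cong : {f g : Subset n → ℕ} → (∀ A → f A ≡ g A) → ∑ f ≡ ∑ g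
∑-cong {zero}  f≗g = f≗g []
∑-cong {suc n} f≗g = cong₂ _+_ (∑-cong (f≗g ∘ (outside ∷_))) (∑-cong (f≗g ∘ (inside ∷_)))

∑-mono : {f g : Subset n → ℕ} → (∀ A → f A ≤ g A) → ∑ f ≤ ∑ g
∑-mono {zero}  f≤g = f≤g []
∑-mono {suc n} f≤g = +-mono-≤ (∑-mono (f≤g ∘ (outside ∷_))) (∑-mono (f≤g ∘ (inside ∷_)))

+-interchange : ∀ a b c d → (a + b) + (c + d) ≡ (a + c) + (b + d)
+-interchange = solve-∀

∑-distrib-+ : (f g : Subset n → ℕ) → ∑ (λ A → f A + g A) ≡ ∑ f + ∑ g
∑-distrib-+ {zero}  f g = refl
∑-distrib-+ {suc n} f g = trans
  (cong₂ _+_ (∑-distrib-+ (f ∘ (outside ∷_)) (g ∘ (outside ∷_)))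
             (∑-distrib-+ (f ∘ (inside ∷_)) (g ∘ (inside ∷_))))
  (+-interchange (∑ (f ∘ (outside ∷_))) (∑ (g ∘ (outside ∷_))) _ _)

∑-const : ∀ n c → ∑ {n} (λ _ → c) ≡ 2 ^ n * c
∑-const zero    c = sym (+-identityʳ c)
∑-const (suc n) c rewrite ∑-const n c = lemma (2 ^ n) c
  where
  lemma : ∀ p c → p * c + p * c ≡ (p + (p + 0)) * c
  lemma = solve-∀

∑-*ʳ : (f : Subset n → ℕ) (c : ℕ) → ∑ (λ A → f A * c) ≡ ∑ f * c
∑-*ʳ {zero}  f c = refl
∑-*ʳ {suc n} f c = trans (cong₂ _+_ (∑-*ʳ (f ∘ (outside ∷_)) c) (∑-*ʳ (f ∘ (inside ∷_)) c))
  (sym (*-distribʳ-+ c (∑ (f ∘ (outside ∷_))) _))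

∑-swap : ∀ {m n} (f : Subset m → Subset n → ℕ) → ∑ (λ A → ∑ (f A)) ≡ ∑ (λ B → ∑ (λ A → f A B))
∑-swap {zero}  f = refl
∑-swap {suc m} f = trans (cong₂ _+_ (∑-swap (f ∘ (outside ∷_))) (∑-swap (f ∘ (inside ∷_))))
  (sym (∑-distrib-+ (λ B → ∑ (λ A → f (outside ∷ A) B)) _))

size-∩-∪ : (F G : Subset n → Bool) → size (F ∩ᶠ G) + size (F ∪ᶠ G) ≡ size F + size G
size-∩-∪ F G = begin
  size (F ∩ᶠ G) + size (F ∪ᶠ G)             ≡⟨ ∑-distrib-+ (𝟙 ∘ (F ∩ᶠ G)) (𝟙 ∘ (F ∪ᶠ G)) ⟨
  ∑ (λ A → 𝟙 ((F ∩ᶠ G) A) + 𝟙 ((F ∪ᶠ G) A)) ≡⟨ ∑-cong (λ A → 𝟙-∧-∨ (F A) (G A)) ⟩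
  ∑ (λ A → 𝟙 (F A) + 𝟙 (G A))               ≡⟨ ∑-distrib-+ (𝟙 ∘ F) (𝟙 ∘ G) ⟩
  size F + size G                           ∎
  where
  open ≡-Reasoning
  𝟙-∧-∨ : ∀ a b → 𝟙 (a ∧ b) + 𝟙 (a ∨ b) ≡ 𝟙 a + 𝟙 b
  𝟙-∧-∨ true  true  = refl
  𝟙-∧-∨ true  false = refl
  𝟙-∧-∨ false b     = refl

size-empty : (F : Subset n → Bool) → (∀ A → ¬ T (F A)) → size F ≡ 0
size-empty {n} F empty = trans (∑-cong (λ A → 𝟙-false (F A) (empty A))) (trans (∑-const n 0) (*-zeroʳ (2 ^ n)))
  where
  𝟙-false : ∀ b → ¬ T b → 𝟙 b ≡ 0
  𝟙-false true  h = contradiction _ h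
  𝟙-false false _ = refl

∩ᶠ⁻ : (F G : Subset n → Bool) → ∀ {A} → T ((F ∩ᶠ G) A) → T (F A) × T (G A)
∩ᶠ⁻ F G = Equivalence.to T-∧

∪ᶠ⁻ : (F G : Subset n → Bool) → ∀ {A} → T ((F ∪ᶠ G) A) → T (F A) ⊎ T (G A)
∪ᶠ⁻ F G = Equivalence.to T-∨

size-∪-disjoint : (F G : Subset n → Bool) → (∀ A → T (F A) → ¬ T (G A)) →
  size (F ∪ᶠ G) ≡ size F + size G
size-∪-disjoint F G disjoint = trans
  (cong (_+ size (F ∪ᶠ G)) (sym (size-empty (F ∩ᶠ G) λ A a →
    disjoint A (proj₁ (∩ᶠ⁻ F G {A} a)) (proj₂ (∩ᶠ⁻ F G {A} a)))))
  (size-∩-∪ F G)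

size-∅ : ∀ n → size {n} (λ _ → false) ≡ 0
size-∅ n = size-empty {n} (λ _ → false) λ _ ()

-- Two families are allowed because the inductions descend, coordinate by coordinate, into different
-- sections for A and for B. The measure μ is `agreement` before compression and `meet` after it.
Cross : ((A B : Subset n) → ℕ) → ℕ → (F G : Subset n → Bool) → Set
Cross μ t F G = ∀ {A B} → T (F A) → T (G B) → t ≤ μ A B

meet : (A B : Subset n) → ℕ
meet A B = ∣ A ∩ B ∣

pred≤⇒≤suc : ∀ {m k} → pred m ≤ k → m ≤ suc k
pred≤⇒≤suc {zero}  _ = z≤n
pred≤⇒≤suc {suc m} h = s≤s h

-- Up-compression

_xnor_ : Bool → Bool → Bool
true  xnor b = b
false xnor b = not b

infixl 8 _⊙_
-- The complement of the symmetric difference, that is, the set of points on which A and B agree. It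
-- is also a group law in which every set is its own inverse, hence the translations.
_⊙_ : (A B : Subset n) → Subset n
_⊙_ = zipWith _xnor_

agreement : (A B : Subset n) → ℕ
agreement A B = ∣ A ⊙ B ∣

-- Compress along each coordinate in turn: a compression replaces A by A with i
-- added unless that set is already present.
up : (Subset n → Bool) → Subset n → Bool
up F []            = F []
up F (outside ∷ A) = up (F ₀ ∩ᶠ F ₁) A
up F (inside  ∷ A) = up (F ₀ ∪ᶠ F ₁) A

size-up : (F : Subset n → Bool) → size (up F) ≡ size F
size-up {zero}  F = refl
size-up {suc n} F = trans (cong₂ _+_ (size-up (F ₀ ∩ᶠ F ₁)) (size-up (F ₀ ∪ᶠ F ₁))) (size-∩-∪ (F ₀) (F ₁))

-- If one of the two sets omits the first point, it comes from both sections of its family, and the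
-- section can be chosen opposite to that of the other set: the agreement then lies entirely in the
-- remaining coordinates. If both contain the point, at most one agreement is lost with it, and the
-- point itself makes up for that one.
up-cross : ∀ {t} (F G : Subset n → Bool) →
  Cross agreement t F G → Cross meet t (up F) (up G)
up-cross F G h {[]} {[]} a b = h a b
up-cross F G h {outside ∷ A} {outside ∷ B} =
  up-cross (F ₀ ∩ᶠ F ₁) (G ₀ ∩ᶠ G ₁) (λ a b →
    h (proj₁ (∩ᶠ⁻ (F ₀) (F ₁) a)) (proj₂ (∩ᶠ⁻ (G ₀) (G ₁) b))) {A} {B}
up-cross F G h {outside ∷ A} {inside ∷ B} =
  up-cross (F ₀ ∩ᶠ F ₁) (G ₀ ∪ᶠ G ₁) (λ a b →
    [ h (proj₂ (∩ᶠ⁻ (F ₀) (F ₁) a)) , h (proj₁ (∩ᶠ⁻ (F ₀) (F ₁) a)) ]′ (∪ᶠ⁻ (G ₀) (G ₁) b)) {A} {B}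
up-cross F G h {inside ∷ A} {outside ∷ B} =
  up-cross (F ₀ ∪ᶠ F ₁) (G ₀ ∩ᶠ G ₁) (λ a b →
    [ (λ a₀ → h a₀ (proj₂ (∩ᶠ⁻ (G ₀) (G ₁) b)))
    , (λ a₁ → h a₁ (proj₁ (∩ᶠ⁻ (G ₀) (G ₁) b))) ]′ (∪ᶠ⁻ (F ₀) (F ₁) a)) {A} {B}
up-cross {t = t} F G h {inside ∷ A} {inside ∷ B} a b =
  pred≤⇒≤suc (up-cross (F ₀ ∪ᶠ F ₁) (G ₀ ∪ᶠ G ₁) rest {A} {B} a b)
  where
  rest : Cross agreement (pred t) (F ₀ ∪ᶠ F ₁) (G ₀ ∪ᶠ G ₁)
  rest a b with ∪ᶠ⁻ (F ₀) (F ₁) a | ∪ᶠ⁻ (G ₀) (G ₁) b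
  ... | inj₁ a₀ | inj₁ b₀ = pred-mono-≤ (h a₀ b₀)
  ... | inj₁ a₀ | inj₂ b₁ = ≤-trans pred[n]≤n (h a₀ b₁)
  ... | inj₂ a₁ | inj₁ b₀ = ≤-trans pred[n]≤n (h a₁ b₀)
  ... | inj₂ a₁ | inj₂ b₁ = pred-mono-≤ (h a₁ b₁)

-- Shifting to the first element

-- For each i in turn, replace i by the new point in the members of X (the sets
-- omitting the new point), unless the resulting set is already in Y (the traces
-- of the sets containing it). One pass suffices: X only shrinks and Y only grows,
-- so no step undoes the closure obtained by an earlier one.
shift₀ shift₁ : (X Y : Subset n → Bool) → Subset n → Bool
shift₀ X Y []            = X []
shift₀ X Y (outside ∷ A) = shift₀ (X ₀) (X ₁ ∪ᶠ Y ₀) A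
shift₀ X Y (inside  ∷ A) = shift₀ (X ₁ ∩ᶠ Y ₀) (Y ₁) A
shift₁ X Y []            = Y []
shift₁ X Y (outside ∷ A) = shift₁ (X ₀) (X ₁ ∪ᶠ Y ₀) A
shift₁ X Y (inside  ∷ A) = shift₁ (X ₁ ∩ᶠ Y ₀) (Y ₁) A

-- At each coordinate the sets of `X ₁` missing from `Y ₀` move over, so that this pair becomes its
-- intersection and its union.
size-shift : (X Y : Subset n → Bool) → size (shift₀ X Y) + size (shift₁ X Y) ≡ size X + size Y
size-shift {zero}  X Y = refl
size-shift {suc n} X Y = begin
  (size (shift₀ (X ₀) P) + size (shift₀ Q (Y ₁))) + (size (shift₁ (X ₀) P) + size (shift₁ Q (Y ₁)))
    ≡⟨ +-interchange (size (shift₀ (X ₀) P)) _ _ _ ⟩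
  (size (shift₀ (X ₀) P) + size (shift₁ (X ₀) P)) + (size (shift₀ Q (Y ₁)) + size (shift₁ Q (Y ₁)))
    ≡⟨ cong₂ _+_ (size-shift (X ₀) P) (size-shift Q (Y ₁)) ⟩
  (size (X ₀) + size P) + (size Q + size (Y ₁))
    ≡⟨ rearrange (size (X ₀)) (size P) (size Q) (size (Y ₁)) ⟩
  size (X ₀) + (size Q + size P) + size (Y ₁)
    ≡⟨ cong (λ s → size (X ₀) + s + size (Y ₁)) (size-∩-∪ (X ₁) (Y ₀)) ⟩
  size (X ₀) + (size (X ₁) + size (Y ₀)) + size (Y ₁)
    ≡⟨ assoc (size (X ₀)) _ _ _ ⟩
  size X + size Y ∎
  where
  open ≡-Reasoning
  P = X ₁ ∪ᶠ Y ₀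
  Q = X ₁ ∩ᶠ Y ₀
  rearrange : ∀ a b c d → (a + b) + (c + d) ≡ a + (c + b) + d
  rearrange = solve-∀
  assoc : ∀ a b c d → a + (b + c) + d ≡ (a + b) + (c + d)
  assoc = solve-∀

shift₀-⊆ : (X Y : Subset n → Bool) → ∀ {A} → T (shift₀ X Y A) → T (X A)
shift₀-⊆ X Y {[]}          a = a
shift₀-⊆ X Y {outside ∷ A} a = shift₀-⊆ (X ₀) (X ₁ ∪ᶠ Y ₀) a
shift₀-⊆ X Y {inside  ∷ A} a = proj₁ (∩ᶠ⁻ (X ₁) (Y ₀) (shift₀-⊆ (X ₁ ∩ᶠ Y ₀) (Y ₁) a))

-- The families on one more point encoded by (X , Y) and (Z , W) cross-t-intersect.
record PairCross (t : ℕ) (X Y Z W : Subset n → Bool) : Set where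
  field
    X-Z : Cross meet t X Z
    X-W : Cross meet t X W
    Y-Z : Cross meet t Y Z
    Y-W : Cross meet (pred t) Y W

module _ {t} {X Y Z W : Subset (suc n) → Bool} (h : PairCross t X Y Z W) where
  open PairCross h

  -- One step of the shift, with the subscripts giving the head coordinates of the two sets. A
  -- member of an intersection belongs to both families and is read in the one where its head avoids
  -- that of the other set, if possible. When both heads are `inside`, they form a common point and
  -- the threshold drops by one.
  pairCross₀₀ : PairCross t (X ₀) (X ₁ ∪ᶠ Y ₀) (Z ₀) (Z ₁ ∪ᶠ W ₀)
  pairCross₀₀ = record
    { X-Z = X-Z
    ; X-W = λ a → [ X-Z a , X-W a ]′ ∘ ∪ᶠ⁻ (Z ₁) (W ₀)
    ; Y-Z = λ a b → [ (λ x → X-Z x b) , (λ y → Y-Z y b) ]′ (∪ᶠ⁻ (X ₁) (Y ₀) a)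
    ; Y-W = rest
    }
    where
    rest : Cross meet (pred t) (X ₁ ∪ᶠ Y ₀) (Z ₁ ∪ᶠ W ₀)
    rest a b with ∪ᶠ⁻ (X ₁) (Y ₀) a | ∪ᶠ⁻ (Z ₁) (W ₀) b
    ... | inj₁ x | inj₁ z = pred-mono-≤ (X-Z x z)
    ... | inj₁ x | inj₂ w = ≤-trans pred[n]≤n (X-W x w)
    ... | inj₂ y | inj₁ z = ≤-trans pred[n]≤n (Y-Z y z)
    ... | inj₂ y | inj₂ w = Y-W y w

  pairCross₀₁ : PairCross t (X ₀) (X ₁ ∪ᶠ Y ₀) (Z ₁ ∩ᶠ W ₀) (W ₁)
  pairCross₀₁ = record
    { X-Z = λ a b → X-Z a (proj₁ (∩ᶠ⁻ (Z ₁) (W ₀) b))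
    ; X-W = X-W
    ; Y-Z = λ a b → [ (λ x → X-W x (proj₂ (∩ᶠ⁻ (Z ₁) (W ₀) b)))
                    , (λ y → Y-Z y (proj₁ (∩ᶠ⁻ (Z ₁) (W ₀) b))) ]′ (∪ᶠ⁻ (X ₁) (Y ₀) a)
    ; Y-W = λ a b → [ (λ x → pred-mono-≤ (X-W x b)) , (λ y → Y-W y b) ]′ (∪ᶠ⁻ (X ₁) (Y ₀) a)
    }

  pairCross₁₀ : PairCross t (X ₁ ∩ᶠ Y ₀) (Y ₁) (Z ₀) (Z ₁ ∪ᶠ W ₀)
  pairCross₁₀ = record
    { X-Z = λ a b → X-Z (proj₁ (∩ᶠ⁻ (X ₁) (Y ₀) a)) b
    ; X-W = λ a → [ Y-Z (proj₂ (∩ᶠ⁻ (X ₁) (Y ₀) a)) , X-W (proj₁ (∩ᶠ⁻ (X ₁) (Y ₀) a)) ]′ ∘ ∪ᶠ⁻ (Z ₁) (W ₀)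
    ; Y-Z = Y-Z
    ; Y-W = λ a → [ (λ z → pred-mono-≤ (Y-Z a z)) , Y-W a ]′ ∘ ∪ᶠ⁻ (Z ₁) (W ₀)
    }

  pairCross₁₁ : PairCross (pred t) (X ₁ ∩ᶠ Y ₀) (Y ₁) (Z ₁ ∩ᶠ W ₀) (W ₁)
  pairCross₁₁ = record
    { X-Z = λ a b → pred-mono-≤ (X-Z (proj₁ (∩ᶠ⁻ (X ₁) (Y ₀) a)) (proj₁ (∩ᶠ⁻ (Z ₁) (W ₀) b)))
    ; X-W = λ a b → pred-mono-≤ (X-W (proj₁ (∩ᶠ⁻ (X ₁) (Y ₀) a)) b)
    ; Y-Z = λ a b → pred-mono-≤ (Y-Z a (proj₁ (∩ᶠ⁻ (Z ₁) (W ₀) b)))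
    ; Y-W = λ a b → pred-mono-≤ (Y-W a b)
    }

-- The gain of one comes from the first common point: sets that were not shifted there had their
-- replacements present already. Such a point exists, since disjoint sets would descend to the empty
-- vectors, where `X-Z` demands at least one common point.
shift₀-cross : ∀ {t} {X Y Z W : Subset n → Bool} → PairCross (suc t) X Y Z W →
  Cross meet (suc (suc t)) (shift₀ X Y) (shift₀ Z W)
shift₀-cross h {[]} {[]} x z = contradiction (PairCross.X-Z h x z) λ ()
shift₀-cross h {outside ∷ A} {outside ∷ B} = shift₀-cross (pairCross₀₀ h) {A} {B}
shift₀-cross h {outside ∷ A} {inside  ∷ B} = shift₀-cross (pairCross₀₁ h) {A} {B}
shift₀-cross h {inside  ∷ A} {outside ∷ B} = shift₀-cross (pairCross₁₀ h) {A} {B}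
-- No induction: A ∈ X ₁ and B ∈ W ₀ already meet in t + 1 points besides the first one.
shift₀-cross {X = X} {Y} {Z} {W} h {inside ∷ A} {inside ∷ B} x z =
  s≤s (PairCross.X-W h (proj₁ (∩ᶠ⁻ (X ₁) (Y ₀) (shift₀-⊆ (X ₁ ∩ᶠ Y ₀) (Y ₁) {A} x)))
                       (proj₂ (∩ᶠ⁻ (Z ₁) (W ₀) (shift₀-⊆ (Z ₁ ∩ᶠ W ₀) (W ₁) {B} z))))

-- Each common point that lowers the threshold in `pairCross₁₁` is paid back by the count, and at
-- the end of the descent `Y-W` remains.
shift₁-cross : ∀ {t} {X Y Z W : Subset n → Bool} → PairCross t X Y Z W →
  Cross meet (pred t) (shift₁ X Y) (shift₁ Z W)
shift₁-cross h {[]} {[]} = PairCross.Y-W h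
shift₁-cross h {outside ∷ A} {outside ∷ B} = shift₁-cross (pairCross₀₀ h) {A} {B}
shift₁-cross h {outside ∷ A} {inside  ∷ B} = shift₁-cross (pairCross₀₁ h) {A} {B}
shift₁-cross h {inside  ∷ A} {outside ∷ B} = shift₁-cross (pairCross₁₀ h) {A} {B}
shift₁-cross h {inside  ∷ A} {inside  ∷ B} y w = pred≤⇒≤suc (shift₁-cross (pairCross₁₁ h) {A} {B} y w)

-- Katona’s intersection theorem

-- A set in F excludes its complement from G. Recursing on opposite sections matches each set with
-- its complement, which is why two families are needed.
1-cross-bound : (F G : Subset n → Bool) → Cross meet 1 F G → size F + size G ≤ 2 ^ n
1-cross-bound {zero} F G h with F [] in F≡ | G [] in G≡
... | true  | true  = contradiction (h {[]} {[]} (subst T (sym F≡) _) (subst T (sym G≡) _)) λ ()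
... | true  | false = ≤-refl
... | false | true  = ≤-refl
... | false | false = z≤n
1-cross-bound {suc n} F G h = begin
  (size (F ₀) + size (F ₁)) + (size (G ₀) + size (G ₁)) ≡⟨ rearrange (size (F ₀)) _ _ _ ⟩
  (size (F ₀) + size (G ₁)) + (size (F ₁) + size (G ₀) + 0)
    ≤⟨ +-mono-≤ (1-cross-bound (F ₀) (G ₁) h) (+-monoˡ-≤ 0 (1-cross-bound (F ₁) (G ₀) h)) ⟩
  2 ^ suc n ∎
  where
  open ≤-Reasoning
  rearrange : ∀ a b c d → (a + b) + (c + d) ≡ (a + d) + (b + c + 0)
  rearrange = solve-∀

halve : ∀ {a b} → a + a ≤ b + b → a ≤ b
halve {a} {b} h = *-cancelˡ-≤ 2 (subst₂ _≤_ (double a) (double b) h)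
  where
  double : ∀ x → x + x ≡ 2 * x
  double = solve-∀

-- The parity e of n + t does not change in the recursion; M n k bounds the
-- families with n + t = e + 2 k.
katona : ∀ e (M : ℕ → ℕ → ℕ) → e ≤ 1 →
  (∀ n k → M (suc n) (suc k) ≡ M n k + M n (suc k)) →
  (∀ n k → suc n + 1 ≡ e + (k + k) → M (suc n) k + M (suc n) k ≡ 2 ^ suc n) →
  ∀ n t k → n + suc t ≡ e + (k + k) →
  (F : Subset n → Bool) → Cross meet (suc t) F F → size F ≤ M n k
katona e M e≤1 pascal half zero t k n+t F h =
  ≤-trans (≤-reflexive (size-empty F λ { [] a → contradiction (h {[]} {[]} a a) λ () })) z≤n
katona e M e≤1 pascal half (suc n) zero k n+t F h = halve (begin
  size F + size F           ≤⟨ 1-cross-bound F F h ⟩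
  2 ^ suc n                 ≡⟨ half n k n+t ⟨
  M (suc n) k + M (suc n) k ∎)
  where open ≤-Reasoning
katona e M e≤1 pascal half (suc n) (suc t) zero n+t F h =
  -- Here the number of points and the threshold add up to at least 3, but their sum is e, at most
  -- 1.
  contradiction (≤-trans (≤-reflexive n+t) (subst (_≤ 1) (sym (+-identityʳ e)) e≤1))
    (λ { (s≤s le) → contradiction (≤-trans (m≤n+m (2 + t) n) le) λ () })
katona e M e≤1 pascal half (suc n) (suc t) (suc k) n+t F h = begin
  size (F ₀) + size (F ₁)
    ≡⟨ size-shift (F ₀) (F ₁) ⟨
  size (shift₀ (F ₀) (F ₁)) + size (shift₁ (F ₀) (F ₁))
    -- With one point fewer, raising the threshold by one keeps the sum of the two, hence `suc k`;
    -- lowering it by one decreases the sum by 2, hence `k`.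
    ≤⟨ +-mono-≤ (katona e M e≤1 pascal half n (2 + t) (suc k) eq₀ _ λ {A} {B} → shift₀-cross cross {A} {B})
                (katona e M e≤1 pascal half n t k eq₁ _ λ {A} {B} → shift₁-cross cross {A} {B}) ⟩
  M n (suc k) + M n k
    ≡⟨ +-comm (M n (suc k)) _ ⟩
  M n k + M n (suc k)
    ≡⟨ pascal n k ⟨
  M (suc n) (suc k) ∎
  where
  open ≤-Reasoning
  cross : PairCross (2 + t) (F ₀) (F ₁) (F ₀) (F ₁)
  cross = record { X-Z = h ; X-W = h ; Y-Z = h ; Y-W = λ a b → pred-mono-≤ (h a b) }
  eq₀ : n + suc (2 + t) ≡ e + (suc k + suc k)
  eq₀ = trans (+-suc n (2 + t)) n+t
  eq₁ : n + suc t ≡ e + (k + k)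
  eq₁ = suc-injective (suc-injective (trans (lhs n t) (trans n+t (rhs e k))))
    where
    lhs : ∀ n t → 2 + (n + suc t) ≡ suc n + suc (suc t)
    lhs = solve-∀
    rhs : ∀ e k → e + (suc k + suc k) ≡ 2 + (e + (k + k))
    rhs = solve-∀

-- Translation averaging

-- Translation permutes the subsets: a point omitted by A exchanges the two halves of the sum, a
-- point of A leaves them in place.
∑-translate : (A : Subset n) (f : Subset n → ℕ) → ∑ (λ X → f (A ⊙ X)) ≡ ∑ f
∑-translate []            f = refl
∑-translate (outside ∷ A) f = trans (+-comm (∑ (λ X → f (inside ∷ A ⊙ X))) _)
  (cong₂ _+_ (∑-translate A (f ∘ (outside ∷_))) (∑-translate A (f ∘ (inside ∷_))))
∑-translate (inside  ∷ A) f =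
  cong₂ _+_ (∑-translate A (f ∘ (outside ∷_))) (∑-translate A (f ∘ (inside ∷_)))

⊙-translate : (A B X : Subset n) → (A ⊙ X) ⊙ (B ⊙ X) ≡ A ⊙ B
⊙-translate []      []      []      = refl
⊙-translate (a ∷ A) (b ∷ B) (x ∷ X) = cong₂ _∷_ (bit a b x) (⊙-translate A B X)
  where
  bit : ∀ a b x → (a xnor x) xnor (b xnor x) ≡ a xnor b
  bit true  true  true  = refl
  bit true  true  false = refl
  bit true  false true  = refl
  bit true  false false = refl
  bit false true  true  = refl
  bit false true  false = refl
  bit false false true  = refl
  bit false false false = refl

agreement-refl : (A : Subset n) → agreement A A ≡ n
agreement-refl []            = refl
agreement-refl (outside ∷ A) = cong suc (agreement-refl A)
agreement-refl (inside  ∷ A) = cong suc (agreement-refl A)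

agreement-comm : (A B : Subset n) → agreement A B ≡ agreement B A
agreement-comm A B = cong ∣_∣ (zipWith-comm xnor-comm A B)
  where
  xnor-comm : ∀ a b → a xnor b ≡ b xnor a
  xnor-comm true  true  = refl
  xnor-comm true  false = refl
  xnor-comm false true  = refl
  xnor-comm false false = refl

meet≤agreement : (A B : Subset n) → meet A B ≤ agreement A B
meet≤agreement []            []            = z≤n
meet≤agreement (outside ∷ A) (outside ∷ B) = m≤n⇒m≤1+n (meet≤agreement A B)
meet≤agreement (outside ∷ A) (inside  ∷ B) = meet≤agreement A B
meet≤agreement (inside  ∷ A) (outside ∷ B) = meet≤agreement A B
meet≤agreement (inside  ∷ A) (inside  ∷ B) = s≤s (meet≤agreement A B)

-- Double counting: each A in V satisfies `K (A ⊙ X)` for exactly `size K` choices of X.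
∑-size-translate : (V K : Subset n → Bool) →
  ∑ (λ X → size (V ∩ᶠ (λ A → K (A ⊙ X)))) ≡ size V * size K
∑-size-translate {n} V K = begin
  ∑ (λ X → size (V ∩ᶠ (λ A → K (A ⊙ X))))    ≡⟨ ∑-swap (λ X A → 𝟙 (V A ∧ K (A ⊙ X))) ⟩
  ∑ (λ A → ∑ (λ X → 𝟙 (V A ∧ K (A ⊙ X))))    ≡⟨ ∑-cong (λ A → ∑-∧ (V A) (λ X → K (A ⊙ X))) ⟩
  ∑ (λ A → 𝟙 (V A) * size (λ X → K (A ⊙ X))) ≡⟨ ∑-cong (λ A → cong (𝟙 (V A) *_) (∑-translate A (𝟙 ∘ K))) ⟩
  ∑ (λ A → 𝟙 (V A) * size K)                 ≡⟨ ∑-*ʳ (𝟙 ∘ V) (size K) ⟩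
  size V * size K                            ∎
  where
  open ≡-Reasoning
  ∑-∧ : ∀ b (F : Subset n → Bool) → ∑ (λ X → 𝟙 (b ∧ F X)) ≡ 𝟙 b * size F
  ∑-∧ true  F = sym (+-identityʳ (size F))
  ∑-∧ false F = size-∅ n

-- Two members of V are compatible as soon as they lie in one translate of K, because translating
-- both preserves their agreement.
local-bound : ∀ {t} {K S V : Subset n → Bool} {N} →
  (∀ (F : Subset n → Bool) → Cross agreement t F F → size F ≤ N) →
  Cross agreement t K K → Cross agreement t S S → Cross agreement t S V →
  (∀ A → T (S A) → ¬ T (V A)) →
  2 ^ n * size S + size V * size K ≤ 2 ^ n * N
local-bound {n} {t} {K} {S} {V} {N} bound K-K S-S S-V disjoint = begin
  2 ^ n * size S + size V * size K
    ≡⟨ cong₂ _+_ (∑-const n (size S)) (∑-size-translate V K) ⟨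
  ∑ {n} (λ _ → size S) + ∑ (λ X → size (V ∩ᶠ Kˣ X))
    ≡⟨ ∑-distrib-+ (λ _ → size S) (λ X → size (V ∩ᶠ Kˣ X)) ⟨
  ∑ (λ X → size S + size (V ∩ᶠ Kˣ X))
    ≤⟨ ∑-mono translated ⟩
  ∑ {n} (λ _ → N)
    ≡⟨ ∑-const n N ⟩
  2 ^ n * N ∎
  where
  open ≤-Reasoning
  Kˣ : Subset n → Subset n → Bool
  Kˣ X A = K (A ⊙ X)
  translated : ∀ X → size S + size (V ∩ᶠ Kˣ X) ≤ N
  translated X = begin
    size S + size (V ∩ᶠ Kˣ X) ≡⟨ size-∪-disjoint S (V ∩ᶠ Kˣ X) (λ A s → disjoint A s ∘ proj₁ ∘ ∩ᶠ⁻ V (Kˣ X) {A}) ⟨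
    size (S ∪ᶠ (V ∩ᶠ Kˣ X))   ≤⟨ bound _ cross ⟩
    N                         ∎
    where
    cross : Cross agreement t (S ∪ᶠ (V ∩ᶠ Kˣ X)) (S ∪ᶠ (V ∩ᶠ Kˣ X))
    cross {A} {B} a b with ∪ᶠ⁻ S (V ∩ᶠ Kˣ X) {A} a | ∪ᶠ⁻ S (V ∩ᶠ Kˣ X) {B} b
    ... | inj₁ s | inj₁ s′ = S-S s s′
    ... | inj₁ s | inj₂ v  = S-V s (proj₁ (∩ᶠ⁻ V (Kˣ X) {B} v))
    ... | inj₂ v | inj₁ s  =
      subst (t ≤_) (agreement-comm B A) (S-V s (proj₁ (∩ᶠ⁻ V (Kˣ X) {A} v)))
    ... | inj₂ v | inj₂ v′ =
      subst (t ≤_) (cong ∣_∣ (⊙-translate A B X))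
        (K-K (proj₂ (∩ᶠ⁻ V (Kˣ X) {A} v)) (proj₂ (∩ᶠ⁻ V (Kˣ X) {B} v′)))

-- Families as lists

does⁻ : ∀ {p} {P : Set p} (P? : Dec P) → T (does P?) → P
does⁻ (yes p) _ = p

does⁺ : ∀ {p} {P : Set p} (P? : Dec P) → P → T (does P?)
does⁺ (yes _) _ = _
does⁺ (no ¬p) p = contradiction p ¬p

_≟ˢ_ : (A B : Subset n) → Dec (A ≡ B)
_≟ˢ_ = ≡-dec _≟ᵇ_

_∈?_ : (A : Subset n) (𝒜 : Family n) → Dec (A ∈ 𝒜)
_∈?_ = DecMembership._∈?_ _≟ˢ_

members : Family n → Subset n → Bool
members 𝒜 A = does (A ∈? 𝒜)

size-singleton : (B : Subset n) → size (λ A → does (A ≟ˢ B)) ≡ 1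
size-singleton []            = refl
size-singleton {suc n} (outside ∷ B) = cong₂ _+_ (size-singleton B) (size-∅ n)
size-singleton {suc n} (inside  ∷ B) = cong₂ _+_ (size-∅ n) (size-singleton B)

size-members : {𝒜 : Family n} → Unique 𝒜 → size (members 𝒜) ≡ length 𝒜
size-members {n} [] = size-∅ n
size-members {𝒜 = B ∷ 𝒜} (B∉𝒜 ∷ unique) = trans
  (size-∪-disjoint (λ A → does (A ≟ˢ B)) (members 𝒜) λ A a a′ →
    All.lookup B∉𝒜 (does⁻ (A ∈? 𝒜) a′) (sym (does⁻ (A ≟ˢ B) a)))
  (cong₂ _+_ (size-singleton B) (size-members unique))

length-filter-map : ∀ {a b p} {A : Set a} {B : Set b} {P : Pred B p} (P? : Decidable P) (f : A → B) xs →
  length (filter P? (map f xs)) ≡ length (filter (λ x → P? (f x)) xs)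
length-filter-map P? f []       = refl
length-filter-map P? f (x ∷ xs) with does (P? (f x))
... | true  = cong suc (length-filter-map P? f xs)
... | false = length-filter-map P? f xs

length-filter-powerset : ∀ n {p} {P : Pred (Subset n) p} (P? : Decidable P) →
  length (filter P? (powerset n)) ≡ size (λ A → does (P? A))
length-filter-powerset zero P? with does (P? [])
... | true  = refl
... | false = refl
length-filter-powerset (suc n) P? = begin
  length (filter P? (map (outside ∷_) (powerset n) ++ map (inside ∷_) (powerset n)))
    ≡⟨ cong length (filter-++ P? (map (outside ∷_) (powerset n)) _) ⟩
  length (filter P? (map (outside ∷_) (powerset n)) ++ filter P? (map (inside ∷_) (powerset n)))
    ≡⟨ length-++ (filter P? (map (outside ∷_) (powerset n))) ⟩
  length (filter P? (map (outside ∷_) (powerset n))) + length (filter P? (map (inside ∷_) (powerset n)))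
    ≡⟨ cong₂ _+_ (half outside) (half inside) ⟩
  size (λ A → does (P? A)) ∎
  where
  open ≡-Reasoning
  half : ∀ x → length (filter P? (map (x ∷_) (powerset n))) ≡ size (λ A → does (P? (x ∷ A)))
  half x = trans (length-filter-map P? (x ∷_) (powerset n)) (length-filter-powerset n (λ A → P? (x ∷ A)))

length-powerset : ∀ n → length (powerset n) ≡ 2 ^ n
length-powerset zero    = refl
length-powerset (suc n) = begin
  length (map (outside ∷_) (powerset n) ++ map (inside ∷_) (powerset n))
    ≡⟨ length-++ (map (outside ∷_) (powerset n)) ⟩
  length (map (outside ∷_) (powerset n)) + length (map (inside ∷_) (powerset n))
    ≡⟨ cong₂ _+_ (length-map _ (powerset n)) (length-map _ (powerset n)) ⟩
  length (powerset n) + length (powerset n)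
    ≡⟨ cong (λ m → m + m) (length-powerset n) ⟩
  2 ^ n + 2 ^ n
    ≡⟨ cong (λ m → 2 ^ n + m) (+-identityʳ _) ⟨
  2 ^ suc n ∎
  where open ≡-Reasoning

powerset-unique : ∀ n → Unique (powerset n)
powerset-unique zero    = [] ∷ []
powerset-unique (suc n) = Unique.++⁺
  (Unique.map⁺ ∷-injectiveʳ (powerset-unique n)) (Unique.map⁺ ∷-injectiveʳ (powerset-unique n)) disjoint
  where
  disjoint : ∀ {A} → A ∈ map (outside ∷_) (powerset n) × A ∈ map (inside ∷_) (powerset n) → _
  disjoint (a , a′) with ∈-map⁻ (outside ∷_) a | ∈-map⁻ (inside ∷_) a′
  ... | _ , _ , refl | _ , _ , ()

subfamily⇒⊆ : {𝒜 : Family n} (ℱ : Family n) → 𝒜 ∈ subfamilies ℱ → 𝒜 ⊆ ℱ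
subfamily⇒⊆ []      (here refl) = []
subfamily⇒⊆ (A ∷ ℱ) 𝒜∈ with ∈-++⁻ (subfamilies ℱ) 𝒜∈
... | inj₁ 𝒜∈ℱ = A ∷ʳ subfamily⇒⊆ ℱ 𝒜∈ℱ
... | inj₂ 𝒜∋A with ∈-map⁻ (A ∷_) 𝒜∋A
... | _ , ℬ∈ℱ , refl = refl ∷ subfamily⇒⊆ ℱ ℬ∈ℱ

Unique-resp-⊆ : ∀ {a} {A : Set a} {xs ys : List A} → xs ⊆ ys → Unique ys → Unique xs
Unique-resp-⊆ []         _           = []
Unique-resp-⊆ (_ ∷ʳ τ)   (_ ∷ uniq)  = Unique-resp-⊆ τ uniq
Unique-resp-⊆ (refl ∷ τ) (x∉ ∷ uniq) = All-resp-⊆ τ x∉ ∷ Unique-resp-⊆ τ uniq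

subfamily-unique : ∀ n {𝒜} → 𝒜 ∈ subfamilies (powerset n) → Unique 𝒜
subfamily-unique n 𝒜∈ = Unique-resp-⊆ (subfamily⇒⊆ (powerset n) 𝒜∈) (powerset-unique n)

filter-subfamily : ∀ {p} {P : Pred (Subset n) p} (P? : Decidable P) ℱ → filter P? ℱ ∈ subfamilies ℱ
filter-subfamily P? []      = here refl
filter-subfamily P? (A ∷ ℱ) with does (P? A)
... | true  = ∈-++⁺ʳ (subfamilies ℱ) (∈-map⁺ (A ∷_) (filter-subfamily P? ℱ))
... | false = ∈-++⁺ˡ (filter-subfamily P? ℱ)

[]-subfamily : (ℱ : Family n) → [] ∈ subfamilies ℱ
[]-subfamily []      = here refl
[]-subfamily (A ∷ ℱ) = ∈-++⁺ˡ ([]-subfamily ℱ)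

-- The extremal families

atLeast : ∀ n → ℕ → Subset n → Bool
atLeast n k A = does (k ≤? ∣ A ∣)

#atLeast : ℕ → ℕ → ℕ
#atLeast n k = size (atLeast n k)

suc≤?suc : ∀ k m → does (suc k ≤? suc m) ≡ does (k ≤? m)
suc≤?suc zero    m = refl
suc≤?suc (suc k) m = refl

#atLeast-zero : ∀ n → #atLeast n 0 ≡ 2 ^ n
#atLeast-zero n = trans (∑-const n 1) (*-identityʳ (2 ^ n))

#atLeast-suc : ∀ n k → #atLeast (suc n) (suc k) ≡ #atLeast n k + #atLeast n (suc k)
#atLeast-suc n k = trans (+-comm (#atLeast n (suc k)) _)
  (cong (_+ #atLeast n (suc k)) (∑-cong (λ (A : Subset n) → cong 𝟙 (suc≤?suc k ∣ A ∣))))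

#atLeast-empty : ∀ n → #atLeast n (suc n) ≡ 0
#atLeast-empty n = size-empty (atLeast n (suc n)) λ A a →
  contradiction (does⁻ (suc n ≤? ∣ A ∣) a) (≤⇒≯ (∣p∣≤n A))

-- Complementation turns the sets of size at least k into those of size at most j - 1. Pascal's rule
-- gives the count without the bijection.
#atLeast-dual : ∀ n j k → j + k ≡ suc n → #atLeast n j + #atLeast n k ≡ 2 ^ n
#atLeast-dual n zero k refl =
  trans (cong₂ _+_ (#atLeast-zero n) (#atLeast-empty n)) (+-identityʳ _)
#atLeast-dual n (suc j) zero eq rewrite suc-injective (trans (sym (+-identityʳ (suc j))) eq) =
  cong₂ _+_ (#atLeast-empty n) (#atLeast-zero n)
#atLeast-dual zero (suc j) (suc k) eq = contradiction (trans (sym (+-suc j k)) (suc-injective eq)) λ ()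
#atLeast-dual (suc n) (suc j) (suc k) eq = begin
  #atLeast (suc n) (suc j) + #atLeast (suc n) (suc k)
    ≡⟨ cong₂ _+_ (#atLeast-suc n j) (#atLeast-suc n k) ⟩
  (#atLeast n j + #atLeast n (suc j)) + (#atLeast n k + #atLeast n (suc k))
    ≡⟨ rearrange (#atLeast n j) (#atLeast n (suc j)) (#atLeast n k) (#atLeast n (suc k)) ⟩
  (#atLeast n j + #atLeast n (suc k)) + (#atLeast n (suc j) + #atLeast n k + 0)
    ≡⟨ cong₂ (λ x y → x + (y + 0))
         (#atLeast-dual n j (suc k) (suc-injective eq))
         (#atLeast-dual n (suc j) k (trans (sym (+-suc j k)) (suc-injective eq))) ⟩
  2 ^ suc n ∎
  where
  open ≡-Reasoning
  rearrange : ∀ a b c d → (a + b) + (c + d) ≡ (a + d) + (b + c + 0)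
  rearrange = solve-∀

-- The value at n = 0 is the one that makes Pascal’s rule hold.
#oddAtLeast : ℕ → ℕ → ℕ
#oddAtLeast zero    k = 0
#oddAtLeast (suc n) k = 2 * #atLeast n k

#oddAtLeast-suc : ∀ n k → #oddAtLeast (suc n) (suc k) ≡ #oddAtLeast n k + #oddAtLeast n (suc k)
#oddAtLeast-suc zero    k = refl
#oddAtLeast-suc (suc n) k = trans (cong (2 *_) (#atLeast-suc n k)) (*-distribˡ-+ 2 (#atLeast n k) _)

-- The last point is free and contributes the factor 2. Vectors being split from the front, it is
-- only reached at the bottom of the induction.
size-oddAtLeast : ∀ n k →
  size {suc n} (λ A → does (k ≤? ∣ A ∩ initial n ∣)) ≡ 2 * #atLeast n k
size-oddAtLeast zero    zero    = refl
size-oddAtLeast zero    (suc k) = refl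
size-oddAtLeast (suc n) zero    = trans (trans (∑-const (2 + n) 1) (*-identityʳ (2 ^ (2 + n))))
  (cong (2 *_) (sym (#atLeast-zero (suc n))))
size-oddAtLeast (suc n) (suc k) = begin
  size {suc n} (λ A → does (suc k ≤? ∣ A ∩ initial n ∣)) +
  size {suc n} (λ A → does (suc k ≤? suc ∣ A ∩ initial n ∣))
    ≡⟨ +-comm (size {suc n} (λ A → does (suc k ≤? ∣ A ∩ initial n ∣))) _ ⟩
  size {suc n} (λ A → does (suc k ≤? suc ∣ A ∩ initial n ∣)) +
  size {suc n} (λ A → does (suc k ≤? ∣ A ∩ initial n ∣))
    ≡⟨ cong₂ _+_
         (trans (∑-cong (λ (A : Subset (suc n)) → cong 𝟙 (suc≤?suc k ∣ A ∩ initial n ∣))) (size-oddAtLeast n k))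
         (size-oddAtLeast n (suc k)) ⟩
  2 * #atLeast n k + 2 * #atLeast n (suc k)
    ≡⟨ *-distribˡ-+ 2 (#atLeast n k) _ ⟨
  2 * (#atLeast n k + #atLeast n (suc k))
    ≡⟨ cong (2 *_) (#atLeast-suc n k) ⟨
  2 * #atLeast (suc n) (suc k) ∎
  where open ≡-Reasoning

∣initial∣ : ∀ n → ∣ initial {suc n} n ∣ ≡ n
∣initial∣ zero    = refl
∣initial∣ (suc n) = cong suc (∣initial∣ n)

-- Inclusion-exclusion inside I. The even case takes I to be the whole set, the odd case all points
-- but the last.
∣A∩I∣+∣B∩I∣≤∣I∣+∣A∩B∣ : (A B I : Subset n) → ∣ A ∩ I ∣ + ∣ B ∩ I ∣ ≤ ∣ I ∣ + ∣ A ∩ B ∣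
∣A∩I∣+∣B∩I∣≤∣I∣+∣A∩B∣ []            []            []            = z≤n
∣A∩I∣+∣B∩I∣≤∣I∣+∣A∩B∣ (a ∷ A) (b ∷ B) (i ∷ I) with ∣A∩I∣+∣B∩I∣≤∣I∣+∣A∩B∣ A B I | a | b | i
... | ih | outside | outside | outside = ih
... | ih | outside | inside  | outside = ih
... | ih | inside  | outside | outside = ih
... | ih | inside  | inside  | outside = ≤-trans (m≤n⇒m≤1+n ih) (≤-reflexive (sym (+-suc ∣ I ∣ _)))
... | ih | outside | outside | inside  = m≤n⇒m≤1+n ih
... | ih | outside | inside  | inside  = ≤-trans (≤-reflexive (+-suc ∣ A ∩ I ∣ _)) (s≤s ih)
... | ih | inside  | outside | inside  = s≤s ih
... | ih | inside  | inside  | inside  =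
  s≤s (subst₂ _≤_ (sym (+-suc ∣ A ∩ I ∣ _)) (sym (+-suc ∣ I ∣ _)) (s≤s ih))

-- Everything that the bounds for `l` and `β` use about `𝒦`; the two parities, with their different
-- predicates, are told apart only in establishing it.
record IsExtremal (n t : ℕ) (𝒦′ : Family n) : Set₁ where
  field
    P       : Pred (Subset n) 0ℓ
    P?      : Decidable P
    𝒦≡      : 𝒦′ ≡ filter P? (powerset n)
    P-meet  : ∀ {A B} → P A → P B → t ≤ ∣ A ∩ B ∣
    maximum : (F : Subset n → Bool) → Cross meet t F F → size F ≤ length 𝒦′

even-or-odd : ∀ m → ∃[ k ] (m ≡ k + k ⊎ m ≡ suc (k + k))
even-or-odd zero    = 0 , inj₁ refl
even-or-odd (suc m) with even-or-odd m
... | k , inj₁ eq = k , inj₂ (cong suc eq)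
... | k , inj₂ eq = suc k , inj₁ (cong suc (trans eq (sym (+-suc k k))))

≤-by-sum : ∀ {n t k m} x y → n + t ≡ k + k → k ≤ x → k ≤ y → x + y ≤ n + m → t ≤ m
≤-by-sum {n} x y eq k≤x k≤y le = +-cancelˡ-≤ n _ _
  (≤-trans (≤-reflexive eq) (≤-trans (+-mono-≤ k≤x k≤y) le))

𝒦-extremal : ∀ n t → 1 ≤ t → t ≤ n → IsExtremal n t (𝒦 n t)
𝒦-extremal n@(suc n′) t@(suc _) _ _ with 2 ∣? (n + t)
... | yes (divides q eq) = record
  { P       = λ A → (n + t) ℕ./ 2 ≤ ∣ A ∣
  ; P?      = λ A → (n + t) ℕ./ 2 ≤? ∣ A ∣
  ; 𝒦≡      = refl
  ; P-meet  = λ {A} {B} a b → ≤-by-sum (∣ A ∣) (∣ B ∣) n+t a b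
                (subst₂ _≤_ (cong₂ (λ C D → ∣ C ∣ + ∣ D ∣) (∩-identityʳ A) (∩-identityʳ B))
                  (cong (_+ ∣ A ∩ B ∣) (∣⊤∣≡n n)) (∣A∩I∣+∣B∩I∣≤∣I∣+∣A∩B∣ A B ⊤))
  ; maximum = λ F h → subst (size F ≤_) (sym (length-filter-powerset n _))
                (katona 0 #atLeast z≤n #atLeast-suc
                  (λ m k eq′ → #atLeast-dual (suc m) k k (trans (sym eq′) (+-comm (suc m) 1)))
                  n _ ((n + t) ℕ./ 2) n+t F h)
  }
  where
  n+t : n + t ≡ (n + t) ℕ./ 2 + (n + t) ℕ./ 2
  n+t = trans eq (trans (double q) (cong (λ x → x + x) (sym (trans (cong (ℕ._/ 2) eq) (m*n/n≡m q 2)))))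
    where
    double : ∀ q → q * 2 ≡ q + q
    double = solve-∀
... | no 2∤n+t = record
  { P       = λ A → (n + t ∸ 1) ℕ./ 2 ≤ ∣ A ∩ initial n′ ∣
  ; P?      = λ A → (n + t ∸ 1) ℕ./ 2 ≤? ∣ A ∩ initial n′ ∣
  ; 𝒦≡      = refl
  ; P-meet  = λ {A} {B} a b → ≤-by-sum (∣ A ∩ initial n′ ∣) (∣ B ∩ initial n′ ∣) n′+t a b
                (subst (λ m → ∣ A ∩ initial n′ ∣ + ∣ B ∩ initial n′ ∣ ≤ m + ∣ A ∩ B ∣)
                  (∣initial∣ n′) (∣A∩I∣+∣B∩I∣≤∣I∣+∣A∩B∣ A B (initial n′)))
  ; maximum = λ F h → subst (size F ≤_)
                (sym (trans (length-filter-powerset n _) (size-oddAtLeast n′ ((n′ + t) ℕ./ 2))))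
                -- The parity e is 1 and k is half of `n′ + t`, to which `n + t ∸ 1` reduces.
                (katona 1 #oddAtLeast ≤-refl #oddAtLeast-suc half n _ ((n′ + t) ℕ./ 2) (cong suc n′+t) F h)
  }
  where
  n′+t : n′ + t ≡ (n′ + t) ℕ./ 2 + (n′ + t) ℕ./ 2
  n′+t with even-or-odd (n′ + t)
  ... | k , inj₁ eq = trans eq (cong (λ x → x + x) (sym (trans (cong (ℕ._/ 2) (trans eq (double k))) (m*n/n≡m k 2))))
    where
    double : ∀ k → k + k ≡ k * 2
    double = solve-∀
  -- Since `n + t` is `suc (n′ + t)`, it would be twice `suc k`.
  ... | k , inj₂ eq = contradiction (divides (suc k) (trans (cong suc eq) (double k))) 2∤n+t
    where
    double : ∀ k → suc (suc (k + k)) ≡ suc k * 2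
    double = solve-∀
  half : ∀ m k → suc m + 1 ≡ 1 + (k + k) →
    #oddAtLeast (suc m) k + #oddAtLeast (suc m) k ≡ 2 ^ suc m
  half m k eq = trans (sym (*-distribˡ-+ 2 (#atLeast m k) _))
    (cong (2 *_) (#atLeast-dual m k k (trans (suc-injective (sym eq)) (+-comm m 1))))

-- The bounds for l and β

kleitman : ∀ {n t 𝒦′} → IsExtremal n t 𝒦′ →
  (F : Subset n → Bool) → Cross agreement t F F → size F ≤ length 𝒦′
kleitman extremal F h = ≤-trans (≤-reflexive (sym (size-up F)))
  (IsExtremal.maximum extremal (up F) λ {A} {B} → up-cross F F h {A} {B})

module _ {n t} (t≤n : t ≤ n) where

  -- The definition of t-intersecting skips the pair A = B. A set agrees with itself on all n
  -- points, so `t ≤ n` settles that pair.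
  meets⇒agreement : ∀ {A B : Subset n} → (A ≢ B → t ≤ ∣ A ∩ B ∣) → t ≤ agreement A B
  meets⇒agreement {A} {B} h with A ≟ˢ B
  ... | yes refl = subst (t ≤_) (sym (agreement-refl A)) t≤n
  ... | no A≢B   = ≤-trans (h A≢B) (meet≤agreement A B)

  members-cross : (ℬ 𝒞 : Family n) → (∀ {A B} → A ∈ ℬ → B ∈ 𝒞 → A ≢ B → t ≤ ∣ A ∩ B ∣) →
    Cross agreement t (members ℬ) (members 𝒞)
  members-cross ℬ 𝒞 h {A} {B} a b = meets⇒agreement (h (does⁻ (A ∈? ℬ) a) (does⁻ (B ∈? 𝒞) b))

  module _ {𝒦′} (extremal : IsExtremal n t 𝒦′) where
    open IsExtremal extremal

    intersecting-bound : ∀ {𝒜} → Unique 𝒜 → Intersecting t 𝒜 → length 𝒜 ≤ length 𝒦′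
    intersecting-bound {𝒜} unique meets = subst (_≤ length 𝒦′) (size-members unique)
      (kleitman extremal (members 𝒜)
        (members-cross 𝒜 𝒜 λ A∈ B∈ → All.lookup (All.lookup meets A∈) B∈))

    𝒦-intersecting : Intersecting t 𝒦′
    𝒦-intersecting rewrite 𝒦≡ =
      All.tabulate λ A∈ → All.tabulate λ B∈ _ →
        P-meet (proj₂ (∈-filter⁻ P? {xs = powerset n} A∈)) (proj₂ (∈-filter⁻ P? {xs = powerset n} B∈))

    𝒦-subfamily : 𝒦′ ∈ subfamilies (powerset n)
    𝒦-subfamily = subst (_∈ subfamilies (powerset n)) (sym 𝒦≡) (filter-subfamily P? (powerset n))

    l-powerset : l (powerset n) t ≡ length 𝒦′
    l-powerset = ≤-antisym
      (max≤v⁺ z≤n (map⁺ (All.tabulate λ 𝒜∈ →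
        let 𝒜∈ℱ , meets = ∈-filter⁻ (intersecting? t) {xs = subfamilies (powerset n)} 𝒜∈
        in intersecting-bound (subfamily-unique n 𝒜∈ℱ) meets)))
      (v≤max⁺ 0 _ (inj₂ (lose (∈-map⁺ length (∈-filter⁺ (intersecting? t) 𝒦-subfamily 𝒦-intersecting)) ≤-refl)))

    split-bound : ∀ {𝒜} → Unique 𝒜 →
      2 ^ n * length (𝒜 ⟨ t ,+⟩) + length (𝒜 ⟨ t ,-⟩) * length 𝒦′ ≤ 2 ^ n * length 𝒦′
    split-bound {𝒜} unique = subst (_≤ 2 ^ n * length 𝒦′)
      (cong₂ _+_ (cong (2 ^ n *_) (size-members (Unique.filter⁺ (meetsOthers? t 𝒜) unique)))
                 (cong₂ _*_ (size-members (Unique.filter⁺ (¬? ∘ meetsOthers? t 𝒜) unique))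
                            (size-members (subfamily-unique n 𝒦-subfamily))))
      (local-bound (kleitman extremal)
        (members-cross 𝒦′ 𝒦′ λ A∈ B∈ → All.lookup (All.lookup 𝒦-intersecting A∈) B∈)
        (members-cross (𝒜 ⟨ t ,+⟩) (𝒜 ⟨ t ,+⟩) λ A∈ B∈ → plus-meets A∈ (proj₁ (∈⁺ B∈)))
        (members-cross (𝒜 ⟨ t ,+⟩) (𝒜 ⟨ t ,-⟩) λ A∈ B∈ → plus-meets A∈ (proj₁ (∈⁻ B∈)))
        λ A a a′ → proj₂ (∈⁻ (does⁻ (A ∈? (𝒜 ⟨ t ,-⟩)) a′)) (proj₂ (∈⁺ (does⁻ (A ∈? (𝒜 ⟨ t ,+⟩)) a))))
      where
      ∈⁺ : ∀ {A} → A ∈ 𝒜 ⟨ t ,+⟩ → A ∈ 𝒜 × MeetsOthers t 𝒜 A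
      ∈⁺ = ∈-filter⁻ (meetsOthers? t 𝒜)
      ∈⁻ : ∀ {A} → A ∈ 𝒜 ⟨ t ,-⟩ → A ∈ 𝒜 × ¬ MeetsOthers t 𝒜 A
      ∈⁻ = ∈-filter⁻ (¬? ∘ meetsOthers? t 𝒜)
      plus-meets : ∀ {A B} → A ∈ 𝒜 ⟨ t ,+⟩ → B ∈ 𝒜 → A ≢ B → t ≤ ∣ A ∩ B ∣
      plus-meets A∈ B∈ = All.lookup (proj₂ (∈⁺ A∈)) B∈

/-≤-/ : ∀ {p q a b} .{{_ : NonZero a}} .{{_ : NonZero b}} →
  p ℤ.* + b ℤ.≤ q ℤ.* + a → p / a ℚ.≤ q / b
/-≤-/ {p} {q} {suc a} {suc b} h = ℚ.toℚᵘ-cancel-≤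
  (ℚᵘ.≤-respˡ-≃ (ℚᵘ.≃-sym (ℚ.toℚᵘ-fromℚᵘ (mkℚᵘ p a)))
    (ℚᵘ.≤-respʳ-≃ (ℚᵘ.≃-sym (ℚ.toℚᵘ-fromℚᵘ (mkℚᵘ q b))) (*≤* h)))

-- Cross-multiplication leaves an inequality of natural numbers. The hypothesis forces `s ≤ l`, N
-- being nonzero, so truncated subtraction agrees with the integer difference.
fraction-bound : ∀ {l s v N} .{{_ : NonZero v}} .{{_ : NonZero N}} →
  N * s + v * l ≤ N * l → + l / N ℚ.≤ (+ l ℤ.- + s) / v
fraction-bound {l} {s} {v} {N} h = /-≤-/ {p = + l} {+ l ℤ.- + s} (begin
  + l ℤ.* + v           ≡⟨ ℤ.pos-* l v ⟨
  + (l * v)             ≤⟨ ℤ.+≤+ (m+n≤o⇒m≤o∸n (l * v) (subst₂ _≤_ (lhs N s v l) (*-comm N l) h)) ⟩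
  + (l * N ∸ s * N)     ≡⟨ cong +_ (*-distribʳ-∸ N l s) ⟨
  + ((l ∸ s) * N)       ≡⟨ ℤ.pos-* (l ∸ s) N ⟩
  + (l ∸ s) ℤ.* + N     ≡⟨ cong (ℤ._* + N) (trans (ℤ.m-n≡m⊖n l s) (ℤ.⊖-≥ s≤l)) ⟨
  (+ l ℤ.- + s) ℤ.* + N ∎)
  where
  open ℤ.≤-Reasoning
  s≤l : s ≤ l
  s≤l = *-cancelˡ-≤ N (m+n≤o⇒m≤o (N * s) h)
  lhs : ∀ N s v l → N * s + v * l ≡ l * v + s * N
  lhs = solve-∀

-- Indexed by the value, so that no goal mentioning l, which would be unfolded, is
-- abstracted over 𝒜 ⟨ t ,-⟩.
data βAtView (ℱ : Family n) .{{_ : NonZero (length ℱ)}} t (𝒜 : Family n) : ℚ → Set where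
  default : βAtView ℱ t 𝒜 (+ l ℱ t / length ℱ)
  ratio   : ∀ v → length (𝒜 ⟨ t ,-⟩) ≡ suc v →
            βAtView ℱ t 𝒜 ((+ l ℱ t ℤ.- + length (𝒜 ⟨ t ,+⟩)) / suc v)

βAt-view : (ℱ : Family n) .{{_ : NonZero (length ℱ)}} → ∀ t 𝒜 → βAtView ℱ t 𝒜 (βAt ℱ t 𝒜)
βAt-view ℱ t 𝒜 with 𝒜 ⟨ t ,-⟩ in eq
... | []    = default
... | _ ∷ 𝒞 = ratio (length 𝒞) (cong length eq)

βAt-bound : ∀ {n t} (ℱ 𝒜 : Family n) .{{_ : NonZero (length ℱ)}} →
  length ℱ * length (𝒜 ⟨ t ,+⟩) + length (𝒜 ⟨ t ,-⟩) * l ℱ t ≤ length ℱ * l ℱ t →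
  + l ℱ t / length ℱ ℚ.≤ βAt ℱ t 𝒜
βAt-bound {t = t} ℱ 𝒜 h = bound (βAt-view ℱ t 𝒜)
  where
  bound : ∀ {q} → βAtView ℱ t 𝒜 q → + l ℱ t / length ℱ ℚ.≤ q
  bound default      = ℚ.≤-refl
  bound (ratio v eq) = fraction-bound {l ℱ t} {length (𝒜 ⟨ t ,+⟩)} {suc v} {length ℱ}
    (subst (λ v → length ℱ * length (𝒜 ⟨ t ,+⟩) + v * l ℱ t ≤ length ℱ * l ℱ t) eq h)

β-powerset : ∀ n t .{{_ : NonZero (length (powerset n))}} → 1 ≤ t → t ≤ n →
  β (powerset n) t ≡ + l (powerset n) t / length (powerset n)
β-powerset n t 1≤t t≤n = ℚ.≤-antisym
  -- The value is attained at the empty subfamily, whose part `⟨ t ,-⟩` is empty.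
  (minℚ≤v⁺ _ _ (inj₂ (lose (∈-map⁺ (βAt (powerset n) t) ([]-subfamily (powerset n))) ℚ.≤-refl)))
  -- The first argument treats the default value of `minℚ`, taken at the whole power set.
  (v≤minℚ⁺ (bound (powerset-unique n)) (map⁺ (All.tabulate (bound ∘ subfamily-unique n))))
  where
  extremal : IsExtremal n t (𝒦 n t)
  extremal = 𝒦-extremal n t 1≤t t≤n
  bound : ∀ {𝒜} → Unique 𝒜 → + l (powerset n) t / length (powerset n) ℚ.≤ βAt (powerset n) t 𝒜
  bound {𝒜} unique = βAt-bound (powerset n) 𝒜
    (subst₂ (λ N k → N * length (𝒜 ⟨ t ,+⟩) + length (𝒜 ⟨ t ,-⟩) * k ≤ N * k)
      (sym (length-powerset n)) (sym (l-powerset t≤n extremal)) (split-bound t≤n extremal unique))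

theorem3p10 : (n t : ℕ) → 1 ≤ t → t ≤ n →
    let instance
          _ = powerset-nonZero n
          _ = m^n≢0 2 n
    in
    (β (powerset n) t ≡ + l (powerset n) t / length (powerset n))
    × (+ l (powerset n) t / length (powerset n) ≡ + length (𝒦 n t) / 2 ^ n)
theorem3p10 n t 1≤t t≤n =
  β-powerset n t {{powerset-nonZero n}} 1≤t t≤n ,
  ℚ./-cong {{powerset-nonZero n}} {{m^n≢0 2 n}}
    (cong +_ (l-powerset t≤n (𝒦-extremal n t 1≤t t≤n))) (length-powerset n)
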